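{- For a permutation $\pi_n$ of $[n]=\{1,\dots,n\}$ and $1\le k\le n$, say that $\pi_n$ consecutively contains a permutation $\mu=(\mu_1,\dots,\mu_k)$ of $[k]$ if there is an index $m$ with $1\le m\le n-k+1$ such that $(\pi_n(m),\pi_n(m+1),\dots,\pi_n(m+k-1))$ is in the same relative order as $(\mu_1,\dots,\mu_k)$. Let $\phi(\pi_n)$ be the number of distinct permutations $\mu$, of all lengths $k$ with $1\le k\le n$, that are consecutively contained in $\pi_n$. Let $\pi_n$ be a uniformly random permutation of $[n]$ and $X=\phi(\pi_n)$. Then, as $n\to\infty$, \[\mathbb{E}(X)=\Big(\max_{\sigma\in S_n}\phi(\sigma)\Big)(1-o(1))=\frac{n^2}{2}(1-o(1)),\] that is, $\mathbb{E}(X)\big/\max_{\sigma\in S_n}\phi(\sigma)\to 1$ and $\mathbb{E}(X)\big/(n^2/2)\to 1$.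
   Context: $S_n$ denotes the set of permutations of $[n]$. Two sequences of distinct numbers of the same length are in the same relative order (order isomorphic) if for all $i,j$, the $i$th entry is smaller than the $j$th entry in one sequence iff the same holds in the other. -}

module Defs where

open import Data.Bool using (Bool; true; false; _∧_; not; if_then_else_)
open import Data.Nat using (ℕ; zero; suc; _+_; _*_; _∸_; _⊔_; _≡ᵇ_; _<ᵇ_; _^_; ∣_-_∣; _≤_)
open import Data.List using (List; []; _∷_; map; concatMap; upTo; length; take; drop; filterᵇ; foldr)
open import Data.Bool.ListAction using (all; any)
open import Data.Nat.ListAction using (sum)

-- Permutations are represented as lists of natural numbers (one-line notation).
-- We use values 0..n-1 instead of 1..n; relative order is unaffected.

-- total lookup with default 0 (only used at in-range indices)
nth : ℕ → List ℕ → ℕ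
nth _       []       = 0
nth zero    (x ∷ xs) = x
nth (suc i) (x ∷ xs) = nth i xs

words : ℕ → ℕ → List (List ℕ)
words n zero    = [] ∷ []
words n (suc k) = concatMap (λ x → map (x ∷_) (words n k)) (upTo n)

distinctᵇ : List ℕ → Bool
distinctᵇ []       = true
distinctᵇ (x ∷ xs) = not (any (λ y → x ≡ᵇ y) xs) ∧ distinctᵇ xs

S : ℕ → List (List ℕ)
S n = filterᵇ distinctᵇ (words n n)

sameOrderᵇ : List ℕ → List ℕ → Bool
sameOrderᵇ xs ys =
  (length xs ≡ᵇ length ys) ∧
  all (λ i → all (λ j → eqB (nth i xs <ᵇ nth j xs) (nth i ys <ᵇ nth j ys))
                 (upTo (length xs)))
      (upTo (length xs))
  where
    eqB : Bool → Bool → Bool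
    eqB true  b = b
    eqB false b = not b

consContainsᵇ : List ℕ → List ℕ → Bool
consContainsᵇ π μ =
  any (λ m → sameOrderᵇ (take (length μ) (drop m π)) μ)
      (upTo (suc (length π ∸ length μ)))

φ : List ℕ → ℕ
φ π = sum (map (λ k → length (filterᵇ (consContainsᵇ π) (S (suc k)))) (upTo (length π)))

-- Σ_{σ ∈ S_n} φ(σ) ;  E(X) = sumφ n / |S_n|
sumφ : ℕ → ℕ
sumφ n = sum (map φ (S n))

card : ℕ → ℕ
card n = length (S n)

maxφ : ℕ → ℕ
maxφ n = foldr _⊔_ 0 (map φ (S n))

{-# OPTIONS --safe #-}
-- A permutation of length n has n − k + 1 windows of length k, so φ ≤ n(n + 1)/2.
-- Conversely, the number of patterns of length k is at least n − k + 1 minus the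
-- number of pairs of windows with the same pattern. For k ≥ 2s, windows starting
-- at j < i with the same pattern have the same ascents at the offsets
-- 0, 2, …, 2s − 2. Swapping the entries at i + 2s and i + 2s + 1 breaks the
-- agreement at offset 2s and keeps it at all smaller even offsets, so each further
-- offset at least halves the number of permutations: a given pair collides with
-- probability at most 2^(−s). Hence E(X) ≥ n²/2 − O(sn) − n³ 2^(−s), and a small
-- linear s suffices.
module Submission where

open import Defs
open import Data.Bool using (Bool; true; false; T; _∧_; not)
open import Data.Bool.ListAction using (all; any)
open import Data.Bool.Properties using (T-≡; T-∧; T-not-≡; not-¬)
import Data.Bool.Properties as Bool
open import Data.Empty using (⊥-elim)
open import Data.List
  using (List; []; _∷_; _++_; [_]; map; length; filter; filterᵇ; upTo; applyUpTo; take; drop; foldr;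
         cartesianProduct; cartesianProductWith; concatMap)
open import Data.List.Membership.Propositional using (_∈_; _∉_; find; lose)
open import Data.List.Membership.Propositional.Properties
open import Data.List.Properties
  using (length-map; length-++; length-upTo; length-applyUpTo; length-take; length-drop; filter-notAll; filter-none; length-filter; upTo-∷ʳ; map-++; ≡-dec)
open import Data.List.Relation.Binary.Permutation.Propositional using (_↭_; prep; swap; ↭-refl; ↭⇒↭ₛ)
open import Data.List.Relation.Binary.Permutation.Propositional.Properties using (↭-length; shift; All-resp-↭)
import Data.List.Relation.Binary.Permutation.Setoid.Properties as ↭ₛ
open import Data.List.Relation.Binary.Subset.Propositional using (_⊆_)
open import Data.List.Relation.Unary.All as All using (All; []; _∷_)
import Data.List.Relation.Unary.All.Properties as All
open import Data.List.Relation.Unary.AllPairs using ([]; _∷_)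
open import Data.List.Relation.Unary.Any as Any using (here; there)
import Data.List.Relation.Unary.Any.Properties as Any
open import Data.List.Relation.Unary.Unique.Propositional using (Unique)
import Data.List.Relation.Unary.Unique.Propositional.Properties as Unique
open import Data.Nat
  using (ℕ; zero; suc; _+_; _*_; _∸_; _⊔_; _^_; _≤_; _<_; _<?_; _≤?_; _<ᵇ_; _≡ᵇ_; ∣_-_∣; z≤n; s≤s; NonZero)
open import Data.Nat.ListAction using (sum)
open import Data.Nat.ListAction.Properties using (sum-++)
open import Data.Nat.Properties
open import Data.Nat.DivMod using (_/_; _%_; m/n*n≤m; m*n/n≡m; /-monoˡ-≤; m≡m%n+[m/n]*n; m%n<n)
open import Data.Nat.Tactic.RingSolver using (solve-∀)
open import Data.Product using (Σ; ∃; ∃₂; _×_; _,_; proj₁; proj₂)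
open import Data.Sum using (inj₁; inj₂)
open import Data.Unit using (⊤; tt)
open import Function using (_∘_; case_of_)
open import Function.Bundles using (Equivalence)
open import Relation.Binary using (DecidableEquality)
open import Relation.Binary.PropositionalEquality hiding ([_])
open import Relation.Nullary using (Dec; yes; no; does; _×-dec_)
open import Relation.Nullary.Negation using (contradiction)

-- Lists without repetitions

∷-unique : ∀ {A : Set} {x : A} {xs} → x ∉ xs → Unique xs → Unique (x ∷ xs)
∷-unique x∉ u = All.tabulate (λ y∈ → λ where refl → x∉ y∈) ∷ u

-- Cut the head of `xs` out of `ys` and recurse: the head does not recur in `xs`, so the tail stays
-- inside the remainder. Most counting below reduces to this bound.
length-⊆ : ∀ {A : Set} {xs ys : List A} → Unique xs → xs ⊆ ys → length xs ≤ length ys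
length-⊆ {xs = []} _ _ = z≤n
length-⊆ {xs = x ∷ xs} (x≢ ∷ u) sub
  with as , bs , refl ← ∈-∃++ (sub (here refl)) = begin
    suc (length xs)           ≤⟨ s≤s (length-⊆ u sub′) ⟩
    suc (length (as ++ bs))   ≡⟨ ↭-length (shift x as bs) ⟨
    length (as ++ x ∷ bs)     ∎
  where
  open ≤-Reasoning
  sub′ : xs ⊆ as ++ bs
  sub′ y∈ with ∈-++⁻ as (sub (there y∈))
  ... | inj₁ y∈as         = ∈-++⁺ˡ y∈as
  ... | inj₂ (here refl)  = contradiction refl (All.lookup x≢ y∈)
  ... | inj₂ (there y∈bs) = ∈-++⁺ʳ as y∈bs

-- Scan the indices in order: each either adds a new value to `xs` or is paired with one earlier
-- index of equal value. Hence the distinct values fall short of `w` by at most the number of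
-- coincidences.
distinct-values : ∀ {A : Set} → DecidableEquality A → (v : ℕ → A) (w : ℕ) →
  ∃₂ λ (xs : List A) (ps : List (ℕ × ℕ)) →
    Unique xs × (∀ {x} → x ∈ xs → ∃ λ i → i < w × x ≡ v i) ×
    Unique ps × (∀ {j i} → (j , i) ∈ ps → j < i × i < w × v j ≡ v i) ×
    w ≤ length xs + length ps
distinct-values _≟_ v zero = [] , [] , [] , (λ ()) , [] , (λ ()) , z≤n
distinct-values _≟_ v (suc w)
  with xs , ps , uxs , xs-val , ups , ps-coll , w≤ ← distinct-values _≟_ v w
  with Any.any? (v w ≟_) xs
... | no v∉ = v w ∷ xs , ps , ∷-unique v∉ uxs
    , (λ { (here refl) → w , n<1+n w , refl
         ; (there x∈) → let i , i<w , eq = xs-val x∈ in i , m<n⇒m<1+n i<w , eq })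
    , ups , (λ p∈ → let j<i , i<w , eq = ps-coll p∈ in j<i , m<n⇒m<1+n i<w , eq)
    , s≤s w≤
... | yes v∈ with j , j<w , eq ← xs-val v∈ = xs , (j , w) ∷ ps , uxs
    , (λ x∈ → let i , i<w , e = xs-val x∈ in i , m<n⇒m<1+n i<w , e)
    , ∷-unique (λ p∈ → n≮n w (proj₁ (proj₂ (ps-coll p∈)))) ups
    , (λ { (here refl) → j<w , n<1+n w , sym eq
         ; (there p∈) → let j<i , i<w , e = ps-coll p∈ in j<i , m<n⇒m<1+n i<w , e })
    , ≤-trans (s≤s w≤) (≤-reflexive (sym (+-suc (length xs) (length ps))))

-- Positional lookup

nth-∈ : ∀ {i} xs → i < length xs → nth i xs ∈ xs
nth-∈ {zero}  (x ∷ xs) _        = here refl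
nth-∈ {suc i} (x ∷ xs) (s≤s i<) = there (nth-∈ xs i<)

nth-ext : ∀ xs ys → length xs ≡ length ys →
  (∀ i → i < length xs → nth i xs ≡ nth i ys) → xs ≡ ys
nth-ext []       []       _  _ = refl
nth-ext (x ∷ xs) (y ∷ ys) le h =
  cong₂ _∷_ (h 0 (s≤s z≤n)) (nth-ext xs ys (suc-injective le) (λ i i< → h (suc i) (s≤s i<)))

nth-map : ∀ (f : ℕ → ℕ) {i} xs → i < length xs → nth i (map f xs) ≡ f (nth i xs)
nth-map f {zero}  (x ∷ xs) _        = refl
nth-map f {suc i} (x ∷ xs) (s≤s i<) = nth-map f xs i<

nth-take : ∀ k {a} xs → a < k → nth a (take k xs) ≡ nth a xs
nth-take (suc k) []       _                = refl
nth-take (suc k) {zero}  (x ∷ xs) _        = refl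
nth-take (suc k) {suc a} (x ∷ xs) (s≤s a<) = nth-take k xs a<

nth-drop : ∀ m a xs → nth a (drop m xs) ≡ nth (m + a) xs
nth-drop zero    a xs       = refl
nth-drop (suc m) a []       = refl
nth-drop (suc m) a (x ∷ xs) = nth-drop m a xs

nth-injective : ∀ {xs i j} → Unique xs → i < length xs → j < length xs → nth i xs ≡ nth j xs → i ≡ j
nth-injective {x ∷ xs} {zero}  {zero}  _       _        _        _  = refl
nth-injective {x ∷ xs} {zero}  {suc j} (p ∷ _) _        (s≤s j<) eq = contradiction eq (All.lookup p (nth-∈ xs j<))
nth-injective {x ∷ xs} {suc i} {zero}  (p ∷ _) (s≤s i<) _        eq = contradiction (sym eq) (All.lookup p (nth-∈ xs i<))
nth-injective {x ∷ xs} {suc i} {suc j} (_ ∷ u) (s≤s i<) (s≤s j<) eq = cong suc (nth-injective u i< j< eq)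

-- Membership in S n

words-suc : ∀ n k → words n (suc k) ≡ cartesianProductWith _∷_ (upTo n) (words n k)
words-suc n k = go (upTo n)
  where
  go : ∀ xs → concatMap (λ x → map (x ∷_) (words n k)) xs ≡ cartesianProductWith _∷_ xs (words n k)
  go []       = refl
  go (x ∷ xs) = cong (map (x ∷_) (words n k) ++_) (go xs)

words-unique : ∀ n k → Unique (words n k)
words-unique n zero    = [] ∷ []
words-unique n (suc k) rewrite words-suc n k =
  Unique.cartesianProductWith⁺ _∷_ (λ { refl → refl , refl }) (Unique.upTo⁺ n) (words-unique n k)

∈-words⁺ : ∀ {n xs} → All (_< n) xs → xs ∈ words n (length xs)
∈-words⁺ []                            = here refl
∈-words⁺ {n} {x ∷ xs} (x< ∷ xs<) rewrite words-suc n (length xs) =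
  ∈-cartesianProductWith⁺ _∷_ (∈-upTo⁺ x<) (∈-words⁺ xs<)

∈-words⁻ : ∀ {n} k {xs} → xs ∈ words n k → length xs ≡ k × All (_< n) xs
∈-words⁻     zero    (here refl) = refl , []
∈-words⁻ {n} (suc k) xs∈ rewrite words-suc n k
  with _ , _ , x∈ , ys∈ , refl ← ∈-cartesianProductWith⁻ _∷_ (upTo n) (words n k) xs∈ =
  let le , ys< = ∈-words⁻ k ys∈ in cong suc le , ∈-upTo⁻ x∈ ∷ ys<

distinctᵇ⁺ : ∀ {xs} → Unique xs → T (distinctᵇ xs)
distinctᵇ⁺ []                          = _
distinctᵇ⁺ {x ∷ xs} (x≢ ∷ u) with any (λ y → x ≡ᵇ y) xs in eq
... | false = distinctᵇ⁺ u
... | true  = let y , y∈ , t = find (Any.any⁻ _ xs (Equivalence.from T-≡ eq))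
              in contradiction (≡ᵇ⇒≡ x y t) (All.lookup x≢ y∈)

distinctᵇ⁻ : ∀ {xs} → T (distinctᵇ xs) → Unique xs
distinctᵇ⁻ {[]}     _ = []
distinctᵇ⁻ {x ∷ xs} t with any (λ y → x ≡ᵇ y) xs in eq
... | false = ∷-unique
  (λ x∈ → subst T eq (Any.any⁺ _ (Any.map (λ x≡y → ≡⇒≡ᵇ x _ x≡y) x∈)))
  (distinctᵇ⁻ t)

record Perm (n : ℕ) (xs : List ℕ) : Set where
  constructor perm
  field
    length≡ : length xs ≡ n
    bounded : All (_< n) xs
    unique  : Unique xs
open Perm

∈-S⁺ : ∀ {n xs} → Perm n xs → xs ∈ S n
∈-S⁺ (perm refl b u) = ∈-filter⁺ _ (∈-words⁺ b) (distinctᵇ⁺ u)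

∈-S⁻ : ∀ {n xs} → xs ∈ S n → Perm n xs
∈-S⁻ {n} xs∈ =
  let xs∈words , d = ∈-filter⁻ _ {xs = words n n} xs∈
      le , b = ∈-words⁻ n xs∈words
  in perm le b (distinctᵇ⁻ d)

S-unique : ∀ n → Unique (S n)
S-unique n = Unique.filter⁺ _ (words-unique n n)

-- Order isomorphism and standardization

OrderIso : List ℕ → List ℕ → Set
OrderIso xs ys = length xs ≡ length ys ×
  (∀ i j → i < length xs → j < length xs → (nth i xs <ᵇ nth j xs) ≡ (nth i ys <ᵇ nth j ys))

-- The comparison of truth values in sameOrderᵇ is local to its definition;
-- unification recovers the matrix of these comparisons.
sameOrder-matrix : ∀ xs ys → Σ (ℕ → ℕ → Bool) λ p →
  sameOrderᵇ xs ys ≡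
    (length xs ≡ᵇ length ys) ∧ all (λ i → all (p i) (upTo (length xs))) (upTo (length xs))
sameOrder-matrix xs ys = _ , refl

entry : List ℕ → List ℕ → ℕ → ℕ → Bool
entry xs ys = proj₁ (sameOrder-matrix xs ys)

entry⁺ : ∀ xs ys i j → (nth i xs <ᵇ nth j xs) ≡ (nth i ys <ᵇ nth j ys) → T (entry xs ys i j)
entry⁺ xs ys i j eq with nth i xs <ᵇ nth j xs
... | true  = Equivalence.from T-≡ (sym eq)
... | false = Equivalence.from T-not-≡ (sym eq)

entry⁻ : ∀ xs ys i j → T (entry xs ys i j) → (nth i xs <ᵇ nth j xs) ≡ (nth i ys <ᵇ nth j ys)
entry⁻ xs ys i j t with nth i xs <ᵇ nth j xs
... | true  = sym (Equivalence.to T-≡ t)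
... | false = sym (Equivalence.to T-not-≡ t)

sameOrderᵇ⁺ : ∀ xs ys → OrderIso xs ys → T (sameOrderᵇ xs ys)
sameOrderᵇ⁺ xs ys (le , h) = Equivalence.from T-∧
  ( ≡⇒≡ᵇ (length xs) _ le
  , All.all⁻ _ (All.tabulate λ {i} i∈ → All.all⁻ (entry xs ys i) (All.tabulate λ {j} j∈ →
      entry⁺ xs ys i j (h i j (∈-upTo⁻ i∈) (∈-upTo⁻ j∈)))))

sameOrderᵇ⁻ : ∀ xs ys → T (sameOrderᵇ xs ys) → OrderIso xs ys
sameOrderᵇ⁻ xs ys t =
  let le , rows = Equivalence.to (T-∧ {length xs ≡ᵇ length ys}) t
  in ≡ᵇ⇒≡ (length xs) _ le , λ i j i< j< → entry⁻ xs ys i j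
       (All.lookup (All.all⁺ _ _ (All.lookup (All.all⁺ _ _ rows) (∈-upTo⁺ i<))) (∈-upTo⁺ j<))

rank : ℕ → List ℕ → ℕ
rank x xs = length (filter (_<? x) xs)

-- A canonical representative of each order type of distinct entries, so that patterns of windows
-- can be compared by equality of lists.
std : List ℕ → List ℕ
std xs = map (λ x → rank x xs) xs

nth-std : ∀ {i} xs → i < length xs → nth i (std xs) ≡ rank (nth i xs) xs
nth-std xs = nth-map (λ x → rank x xs) xs

rank-mono-≤ : ∀ {x y xs} → Unique xs → x ≤ y → rank x xs ≤ rank y xs
rank-mono-≤ {x} {y} {xs} u x≤y = length-⊆ (Unique.filter⁺ (_<? x) u) λ z∈ →
  let z∈xs , z<x = ∈-filter⁻ (_<? x) {xs = xs} z∈ in ∈-filter⁺ (_<? y) z∈xs (<-≤-trans z<x x≤y)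

rank-mono-< : ∀ {x y xs} → Unique xs → x ∈ xs → x < y → rank x xs < rank y xs
rank-mono-< {x} {y} {xs} u x∈ x<y = length-⊆
  (∷-unique (λ x∈f → n≮n x (proj₂ (∈-filter⁻ (_<? x) {xs = xs} x∈f))) (Unique.filter⁺ (_<? x) u))
  λ { (here refl) → ∈-filter⁺ (_<? y) x∈ x<y
    ; (there z∈)  → let z∈xs , z<x = ∈-filter⁻ (_<? x) {xs = xs} z∈
                    in ∈-filter⁺ (_<? y) z∈xs (<-trans z<x x<y) }

rank<length : ∀ {x xs} → x ∈ xs → rank x xs < length xs
rank<length {x} x∈ = filter-notAll (_<? x) _ (Any.map (λ { refl → n≮n x }) x∈)

<ᵇ-cong : ∀ {a b c d} → (a < b → c < d) → (c < d → a < b) → (a <ᵇ b) ≡ (c <ᵇ d)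
<ᵇ-cong {a} {b} {c} {d} f g with a <ᵇ b in eq₁ | c <ᵇ d in eq₂
... | true  | true  = refl
... | false | false = refl
... | true  | false = ⊥-elim (subst T eq₂ (<⇒<ᵇ (f (<ᵇ⇒< a b (Equivalence.from T-≡ eq₁)))))
... | false | true  = ⊥-elim (subst T eq₁ (<⇒<ᵇ (g (<ᵇ⇒< c d (Equivalence.from T-≡ eq₂)))))

std-orderIso : ∀ {xs} → Unique xs → OrderIso xs (std xs)
std-orderIso {xs} u = sym (length-map _ xs) , λ i j i< j< →
  trans (<ᵇ-cong (rank-mono-< u (nth-∈ xs i<))
                 (λ r< → ≰⇒> λ le → <⇒≱ r< (rank-mono-≤ u le)))
        (sym (cong₂ _<ᵇ_ (nth-std xs i<) (nth-std xs j<)))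

rank-cong : ∀ {x y} xs ys → length xs ≡ length ys →
  (∀ j → j < length xs → (nth j xs <ᵇ x) ≡ (nth j ys <ᵇ y)) → rank x xs ≡ rank y ys
rank-cong []       []       _  _ = refl
rank-cong {x} {y} (a ∷ xs) (b ∷ ys) le h
  with a <ᵇ x | b <ᵇ y | h 0 (s≤s z≤n)
     | rank-cong {x} {y} xs ys (suc-injective le) (λ j j< → h (suc j) (s≤s j<))
... | true  | .true  | refl | ih = cong suc ih
... | false | .false | refl | ih = ih

std-cong : ∀ {xs ys} → OrderIso xs ys → std xs ≡ std ys
std-cong {xs} {ys} (le , h) = nth-ext (std xs) (std ys)
  (trans (length-map _ xs) (trans le (sym (length-map _ ys)))) λ i i<std →
  let i<xs = subst (i <_) (length-map _ xs) i<std
      i<ys = subst (i <_) le i<xs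
  in trans (nth-std xs i<xs)
       (trans (rank-cong xs ys le (λ j j< → h j i j< i<xs)) (sym (nth-std ys i<ys)))

-- Entries below `x` are distinct elements of `upTo x`, which gives `below`. Of the `k` distinct
-- entries at most `k ∸ x` are `x` or larger, so at least `x` are smaller, which gives `above`.
rank-perm : ∀ {k x μ} → Perm k μ → x ∈ μ → rank x μ ≡ x
rank-perm {k} {x} {μ} (perm le b u) x∈ = ≤-antisym below above
  where
  open ≤-Reasoning
  x≤k : x ≤ k
  x≤k = <⇒≤ (All.lookup b x∈)

  below : rank x μ ≤ x
  below = subst (rank x μ ≤_) (length-upTo x) (length-⊆ (Unique.filter⁺ (_<? x) u)
    λ z∈ → ∈-upTo⁺ (proj₂ (∈-filter⁻ (_<? x) {xs = μ} z∈)))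

  split : μ ⊆ filter (_<? x) μ ++ applyUpTo (x +_) (k ∸ x)
  split {z} z∈ with z <? x
  ... | yes z<x = ∈-++⁺ˡ (∈-filter⁺ (_<? x) z∈ z<x)
  ... | no  z≮x = ∈-++⁺ʳ (filter (_<? x) μ)
    (subst (_∈ applyUpTo (x +_) (k ∸ x)) (m+[n∸m]≡n x≤z)
      (∈-applyUpTo⁺ (x +_) (∸-monoˡ-< (All.lookup b z∈) x≤z)))
    where x≤z = ≮⇒≥ z≮x

  above : x ≤ rank x μ
  above = +-cancelʳ-≤ (k ∸ x) x (rank x μ) (begin
    x + (k ∸ x)                                              ≡⟨ m+[n∸m]≡n x≤k ⟩
    k                                                        ≡⟨ le ⟨
    length μ                                                 ≤⟨ length-⊆ u split ⟩
    length (filter (_<? x) μ ++ applyUpTo (x +_) (k ∸ x))    ≡⟨ length-++ (filter (_<? x) μ) ⟩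
    rank x μ + length (applyUpTo (x +_) (k ∸ x))             ≡⟨ cong (rank x μ +_) (length-applyUpTo (x +_) (k ∸ x)) ⟩
    rank x μ + (k ∸ x)                                       ∎)

std-perm : ∀ {k μ} → Perm k μ → std μ ≡ μ
std-perm {μ = μ} p = nth-ext (std μ) μ (length-map _ μ) λ i i<std →
  let i< = subst (i <_) (length-map _ μ) i<std
  in trans (nth-std μ i<) (rank-perm p (nth-∈ μ i<))

std-isPerm : ∀ {xs} → Unique xs → Perm (length xs) (std xs)
std-isPerm {xs} u = perm (length-map _ xs)
  (All.map⁺ (All.tabulate rank<length)) (map-unique u (λ x∈ → x∈))
  where
  rank-≢ : ∀ {x y} → x ∈ xs → y ∈ xs → x ≢ y → rank x xs ≢ rank y xs
  rank-≢ x∈ y∈ x≢y eq with ≤-total _ _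
  ... | inj₁ x≤y = <⇒≢ (rank-mono-< u x∈ (≤∧≢⇒< x≤y x≢y)) eq
  ... | inj₂ y≤x = <⇒≢ (rank-mono-< u y∈ (≤∧≢⇒< y≤x (x≢y ∘ sym))) (sym eq)

  -- The induction shortens `ys` while the ranks are still taken in all of `xs`.
  map-unique : ∀ {ys} → Unique ys → ys ⊆ xs → Unique (map (λ x → rank x xs) ys)
  map-unique []       _   = []
  map-unique (p ∷ us) sub =
    All.map⁺ (All.tabulate λ y∈ → rank-≢ (sub (here refl)) (sub (there y∈)) (All.lookup p y∈))
    ∷ map-unique us (sub ∘ there)

-- Patterns of a given length

window : ℕ → List ℕ → ℕ → List ℕ
window k π m = take k (drop m π)

patterns : List ℕ → ℕ → List (List ℕ)
patterns π k = filterᵇ (consContainsᵇ π) (S k)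

length-window : ∀ {k m} π → m + k ≤ length π → length (window k π m) ≡ k
length-window {k} {m} π le = trans (length-take k (drop m π))
  (m≤n⇒m⊓n≡m (subst (k ≤_) (sym (length-drop m π)) (m+n≤o⇒m≤o∸n k (subst (_≤ length π) (+-comm m k) le))))

window-unique : ∀ {k π m} → Unique π → Unique (window k π m)
window-unique {k} {π} {m} u = Unique.take⁺ k (Unique.drop⁺ m u)

-- A contained pattern is its own standardization, hence also that of the window it matches. So all
-- patterns occur among the standardized windows, one for each starting position.
patterns-≤ : ∀ π k → length (patterns π k) ≤ suc (length π ∸ k)
patterns-≤ π k = begin
  length (patterns π k)               ≤⟨ length-⊆ (Unique.filter⁺ _ (S-unique k)) sub ⟩
  length (map (std ∘ window k π) ms)  ≡⟨ trans (length-map _ ms) (length-upTo _) ⟩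
  suc (length π ∸ k)                  ∎
  where
  open ≤-Reasoning
  ms = upTo (suc (length π ∸ k))
  sub : patterns π k ⊆ map (std ∘ window k π) ms
  sub {μ} μ∈ with μ∈S , c ← ∈-filter⁻ _ {xs = S k} μ∈ with p@(perm refl _ _) ← ∈-S⁻ {k} μ∈S =
    let m , m∈ , t = find (Any.any⁻ (λ m → sameOrderᵇ (window (length μ) π m) μ) ms c)
        iso = sameOrderᵇ⁻ (window (length μ) π m) μ t
    in subst (_∈ map (std ∘ window (length μ) π) ms) (trans (std-cong iso) (std-perm p))
         (∈-map⁺ (std ∘ window (length μ) π) m∈)

std-window-∈ : ∀ {π k m} → Unique π → m + k ≤ length π → std (window k π m) ∈ patterns π k
std-window-∈ {π} {k} {m} u le =
  ∈-filter⁺ _ (∈-S⁺ p) (Any.any⁺ _ (lose (∈-upTo⁺ m<) (sameOrderᵇ⁺ (window (length (std (window k π m))) π m) (std (window k π m)) iso)))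
  where
  uw = window-unique {k} {π} {m} u
  p : Perm k (std (window k π m))
  p = subst (λ l → Perm l (std (window k π m))) (length-window π le) (std-isPerm uw)
  -- `consContainsᵇ` cuts windows to the length of the pattern, which equals `k` only
  -- propositionally.
  iso : OrderIso (window (length (std (window k π m))) π m) (std (window k π m))
  iso = subst (λ l → OrderIso (window l π m) (std (window k π m))) (sym (length≡ p)) (std-orderIso uw)
  m< : m < suc (length π ∸ length (std (window k π m)))
  m< rewrite length≡ p = s≤s (m+n≤o⇒m≤o∸n m le)

-- Collisions between windows

up : ℕ → List ℕ → Bool
up p π = nth p π <ᵇ nth (suc p) π

-- Only even offsets are compared, so that those after i are about disjoint entries.
Collide : ℕ → ℕ → ℕ → List ℕ → Set
Collide zero    j i π = ⊤
Collide (suc s) j i π = Collide s j i π × up (j + s * 2) π ≡ up (i + s * 2) π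

collide? : ∀ s j i π → Dec (Collide s j i π)
collide? zero    j i π = yes tt
collide? (suc s) j i π = collide? s j i π ×-dec (up (j + s * 2) π Bool.≟ up (i + s * 2) π)

up-std-window : ∀ {k π m a} → Unique π → m + k ≤ length π → suc a < k →
  up a (std (window k π m)) ≡ up (m + a) π
up-std-window {k} {π} {m} {a} u le a+1< = begin
  up a (std w)                            ≡⟨ proj₂ (std-orderIso (window-unique {k} {π} {m} u)) a (suc a) (in-w (<⇒≤ a+1<)) (in-w a+1<) ⟨
  (nth a w <ᵇ nth (suc a) w)              ≡⟨ cong₂ _<ᵇ_ (nth-w (<⇒≤ a+1<)) (nth-w a+1<) ⟩
  (nth (m + a) π <ᵇ nth (m + suc a) π)    ≡⟨ cong (λ p → nth (m + a) π <ᵇ nth p π) (+-suc m a) ⟩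
  up (m + a) π                            ∎
  where
  open ≡-Reasoning
  w = window k π m
  in-w : ∀ {b} → b < k → b < length w
  in-w = subst (_ <_) (sym (length-window π le))
  nth-w : ∀ {b} → b < k → nth b w ≡ nth (m + b) π
  nth-w {b} b< = trans (nth-take k (drop m π) b<) (nth-drop m b π)

-- Standardization preserves ascents, so equal patterns agree at every offset. The last offset
-- compared is 2s - 2, which reads entries up to offset 2s - 1; a window of length 2s suffices.
std-window-collide : ∀ s {k j i π} → Unique π → s * 2 ≤ k → j + k ≤ length π → i + k ≤ length π →
  std (window k π j) ≡ std (window k π i) → Collide s j i π
std-window-collide zero    _ _   _  _  _  = tt
std-window-collide (suc s) u s≤k j≤ i≤ eq =
  std-window-collide s u (≤-trans (m≤n+m (s * 2) 2) s≤k) j≤ i≤ eq ,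
  trans (sym (up-std-window u j≤ s≤k)) (trans (cong (up (s * 2)) eq) (up-std-window u i≤ s≤k))

-- Transpositions of adjacent entries

swapAt : ℕ → List ℕ → List ℕ
swapAt zero    (x ∷ y ∷ xs) = y ∷ x ∷ xs
swapAt (suc p) (x ∷ xs)     = x ∷ swapAt p xs
swapAt _       xs           = xs

swapAt-involutive : ∀ p xs → swapAt p (swapAt p xs) ≡ xs
swapAt-involutive zero    []           = refl
swapAt-involutive zero    (x ∷ [])     = refl
swapAt-involutive zero    (x ∷ y ∷ xs) = refl
swapAt-involutive (suc p) []           = refl
swapAt-involutive (suc p) (x ∷ xs)     = cong (x ∷_) (swapAt-involutive p xs)

swapAt-injective : ∀ p {xs ys} → swapAt p xs ≡ swapAt p ys → xs ≡ ys
swapAt-injective p {xs} {ys} eq =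
  trans (sym (swapAt-involutive p xs)) (trans (cong (swapAt p) eq) (swapAt-involutive p ys))

swapAt-↭ : ∀ p xs → xs ↭ swapAt p xs
swapAt-↭ zero    []           = ↭-refl
swapAt-↭ zero    (x ∷ [])     = ↭-refl
swapAt-↭ zero    (x ∷ y ∷ xs) = swap x y ↭-refl
swapAt-↭ (suc p) []           = ↭-refl
swapAt-↭ (suc p) (x ∷ xs)     = prep x (swapAt-↭ p xs)

swapAt-S : ∀ {n} p {π} → π ∈ S n → swapAt p π ∈ S n
swapAt-S {n} p {π} π∈ with perm le b u ← ∈-S⁻ {n} π∈ = ∈-S⁺ (perm
  (trans (sym (↭-length (swapAt-↭ p π))) le)
  (All-resp-↭ (swapAt-↭ p π) b)
  (↭ₛ.Unique-resp-↭ (setoid ℕ) (↭⇒↭ₛ (swapAt-↭ p π)) u))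

nth-swapAt-< : ∀ {p q} xs → q < p → nth q (swapAt p xs) ≡ nth q xs
nth-swapAt-< {suc p} {_}     []       _         = refl
nth-swapAt-< {suc p} {zero}  (x ∷ xs) _         = refl
nth-swapAt-< {suc p} {suc q} (x ∷ xs) (s≤s q<p) = nth-swapAt-< xs q<p

nth-swapAt-first : ∀ p xs → suc p < length xs → nth p (swapAt p xs) ≡ nth (suc p) xs
nth-swapAt-first zero    (x ∷ y ∷ xs) _        = refl
nth-swapAt-first zero    (x ∷ [])     (s≤s ())
nth-swapAt-first (suc p) (x ∷ xs)     (s≤s p<) = nth-swapAt-first p xs p<

nth-swapAt-second : ∀ p xs → suc p < length xs → nth (suc p) (swapAt p xs) ≡ nth p xs
nth-swapAt-second zero    (x ∷ y ∷ xs) _        = refl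
nth-swapAt-second zero    (x ∷ [])     (s≤s ())
nth-swapAt-second (suc p) (x ∷ xs)     (s≤s p<) = nth-swapAt-second p xs p<

up-swapAt-< : ∀ {p q} xs → suc q < p → up q (swapAt p xs) ≡ up q xs
up-swapAt-< xs q+1<p = cong₂ _<ᵇ_ (nth-swapAt-< xs (<⇒≤ q+1<p)) (nth-swapAt-< xs q+1<p)

<ᵇ-true : ∀ {x y} → x < y → (x <ᵇ y) ≡ true
<ᵇ-true x<y = Equivalence.to T-≡ (<⇒<ᵇ x<y)

<ᵇ-false : ∀ {x y} → y ≤ x → (x <ᵇ y) ≡ false
<ᵇ-false {x} {y} y≤x with x <ᵇ y in eq
... | false = refl
... | true  = contradiction (<ᵇ⇒< x y (Equivalence.from T-≡ eq)) (≤⇒≯ y≤x)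

<ᵇ-swap : ∀ {x y} → x ≢ y → (y <ᵇ x) ≡ not (x <ᵇ y)
<ᵇ-swap {x} {y} x≢y with x <? y
... | yes x<y = trans (<ᵇ-false (<⇒≤ x<y)) (sym (cong not (<ᵇ-true x<y)))
... | no  x≮y = trans (<ᵇ-true (≤∧≢⇒< (≮⇒≥ x≮y) (x≢y ∘ sym))) (sym (cong not (<ᵇ-false (≮⇒≥ x≮y))))

-- Equal outcomes force `x < y < z` or `z ≤ y ≤ x`, and transitivity settles the outer comparison.
<ᵇ-chain : ∀ x y z → (x <ᵇ y) ≡ (y <ᵇ z) → (x <ᵇ z) ≡ (x <ᵇ y)
<ᵇ-chain x y z eq with x <? y
... | yes x<y = trans (<ᵇ-true (<-trans x<y y<z)) (sym (<ᵇ-true x<y))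
  where
  y<z : y < z
  y<z = <ᵇ⇒< y z (Equivalence.from T-≡ (trans (sym eq) (<ᵇ-true x<y)))
... | no  x≮y = trans (<ᵇ-false (≤-trans z≤y (≮⇒≥ x≮y))) (sym (<ᵇ-false (≮⇒≥ x≮y)))
  where
  z≤y : z ≤ y
  z≤y = ≮⇒≥ λ y<z → case trans (sym (<ᵇ-true y<z)) (trans (sym eq) (<ᵇ-false (≮⇒≥ x≮y))) of λ ()

up-swapAt : ∀ {p xs} → Unique xs → suc p < length xs → up p (swapAt p xs) ≡ not (up p xs)
up-swapAt {p} {xs} u p< = trans
  (cong₂ _<ᵇ_ (nth-swapAt-first p xs p<) (nth-swapAt-second p xs p<))
  (<ᵇ-swap λ eq → 1+n≢n (sym (nth-injective u (<⇒≤ p<) p< eq)))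

-- The swap negates the ascent at `p`, as the entries are distinct, but leaves the one at `q`
-- unchanged, even when the two adjacent pairs share an entry.
swapAt-separates : ∀ {p q xs} → Unique xs → suc p < length xs → q < p → up q xs ≡ up p xs →
  up q (swapAt p xs) ≢ up p (swapAt p xs)
swapAt-separates {p} {q} {xs} u p< q<p eq eq′ =
  not-¬ refl (trans (sym eq) (trans (sym up-q) (trans eq′ (up-swapAt u p<))))
  where
  up-q : up q (swapAt p xs) ≡ up q xs
  up-q with m≤n⇒m<n∨m≡n q<p
  ... | inj₁ q+1<p = up-swapAt-< xs q+1<p
  -- The two adjacent pairs overlap: the values x, y, z at q, p, p + 1 are
  -- monotone, so comparing x with z gives the same answer as comparing x with y.
  ... | inj₂ refl  = trans
    (cong₂ _<ᵇ_ (nth-swapAt-< xs (n<1+n q)) (nth-swapAt-first (suc q) xs p<))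
    (<ᵇ-chain (nth q xs) (nth (suc q) xs) (nth (suc (suc q)) xs) eq)

-- `Collide r` reads only positions below i + 2r, all of them before the swapped entries. With `r`
-- separate from `s`, the induction can lower `r` while the swap stays in place.
collide-swapAt : ∀ r {s j i π} → r ≤ s → j < i → Collide r j i π → Collide r j i (swapAt (i + s * 2) π)
collide-swapAt zero    _   _   _       = tt
collide-swapAt (suc r) {s} {j} {i} {π} r<s j<i (c , eq) = collide-swapAt r (<⇒≤ r<s) j<i c ,
  trans (up-swapAt-< π (≤-<-trans (s≤s (+-monoˡ-≤ (r * 2) (<⇒≤ j<i))) i<))
    (trans eq (sym (up-swapAt-< π i<)))
  where
  i< : suc (i + r * 2) < i + s * 2
  i< = subst (_≤ i + s * 2) (trans (+-suc i (suc (r * 2))) (cong suc (+-suc i (r * 2))))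
         (+-monoʳ-≤ i (*-monoˡ-≤ 2 r<s))

-- The permutations agreeing at the additional offset and their images under an injective swap form
-- two disjoint families of equal size, both within those agreeing at the first `s` offsets.
collide-halves : ∀ {n} s {j i} → j < i → i + suc s * 2 ≤ n →
  2 * length (filter (collide? (suc s) j i) (S n)) ≤ length (filter (collide? s j i) (S n))
collide-halves {n} s {j} {i} j<i i≤ = begin
  2 * length ys                                ≡⟨ cong (length ys +_) (+-identityʳ _) ⟩
  length ys + length ys                        ≡⟨ cong (length ys +_) (length-map (swapAt p) ys) ⟨
  length ys + length (map (swapAt p) ys)       ≡⟨ length-++ ys ⟨
  length (ys ++ map (swapAt p) ys)             ≤⟨ length-⊆ uniq sub ⟩
  length (filter (collide? s j i) (S n))       ∎
  where
  open ≤-Reasoning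
  p  = i + s * 2
  ys = filter (collide? (suc s) j i) (S n)
  ys⁻ : ∀ {π} → π ∈ ys → π ∈ S n × Collide (suc s) j i π
  ys⁻ = ∈-filter⁻ (collide? (suc s) j i) {xs = S n}
  p< : suc p < n
  p< = subst (_≤ n) (trans (+-suc i (suc (s * 2))) (cong suc (+-suc i (s * 2)))) i≤
  uys : Unique ys
  uys = Unique.filter⁺ (collide? (suc s) j i) (S-unique n)
  uniq : Unique (ys ++ map (swapAt p) ys)
  -- A common element would be the swap of some `π` in `ys`, with agreement at the last offset both
  -- before and after the swap.
  uniq = Unique.++⁺ uys (Unique.map⁺ (swapAt-injective p) uys) λ (∈ys , ∈map) →
    let π , π∈ , eq = ∈-map⁻ (swapAt p) ∈map
        π∈S , _ , up≡ = ys⁻ π∈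
        perm le _ u = ∈-S⁻ {n} π∈S
        _ , _ , up≡′ = ys⁻ (subst (_∈ ys) eq ∈ys)
    in swapAt-separates u (subst (suc p <_) (sym le) p<) (+-monoˡ-< (s * 2) j<i) up≡ up≡′
  sub : ys ++ map (swapAt p) ys ⊆ filter (collide? s j i) (S n)
  sub π∈ with ∈-++⁻ ys π∈
  ... | inj₁ π∈ys = let π∈S , c , _ = ys⁻ π∈ys in ∈-filter⁺ (collide? s j i) π∈S c
  ... | inj₂ ∈map with π , π∈ys , refl ← ∈-map⁻ (swapAt p) ∈map =
    let π∈S , c , _ = ys⁻ π∈ys
    in ∈-filter⁺ (collide? s j i) (swapAt-S {n} p π∈S) (collide-swapAt s ≤-refl j<i c)

collide-count : ∀ {n} s {j i} → j < i → i + s * 2 ≤ n →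
  2 ^ s * length (filter (collide? s j i) (S n)) ≤ card n
collide-count {n} zero {j} {i} j<i i≤ =
  ≤-trans (≤-reflexive (*-identityˡ _)) (length-filter (collide? 0 j i) (S n))
collide-count {n} (suc s) {j} {i} j<i i≤ = begin
  2 * 2 ^ s * C (suc s)      ≡⟨ cong (_* C (suc s)) (*-comm 2 (2 ^ s)) ⟩
  2 ^ s * 2 * C (suc s)      ≡⟨ *-assoc (2 ^ s) 2 (C (suc s)) ⟩
  2 ^ s * (2 * C (suc s))    ≤⟨ *-monoʳ-≤ (2 ^ s) (collide-halves s j<i i≤) ⟩
  2 ^ s * C s                ≤⟨ collide-count s j<i (≤-trans (+-monoʳ-≤ i (m≤n+m (s * 2) 2)) i≤) ⟩
  card n                     ∎
  where
  open ≤-Reasoning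
  C : ℕ → ℕ
  C r = length (filter (collide? r j i) (S n))

-- Double counting of collisions

Collision : ℕ → ℕ → List ℕ → ℕ × ℕ → Set
Collision n s π (j , i) = j < i × i + s * 2 ≤ n × Collide s j i π

collision? : ∀ n s π ji → Dec (Collision n s π ji)
collision? n s π (j , i) = (j <? i) ×-dec (i + s * 2 ≤? n) ×-dec collide? s j i π

pairs : ℕ → List (ℕ × ℕ)
pairs n = cartesianProduct (upTo n) (upTo n)

collisions : ℕ → ℕ → List ℕ → ℕ
collisions n s π = length (filter (collision? n s π) (pairs n))

-- The position constraints belong to `Collision`, so inadmissible pairs give an empty list and the
-- bound is uniform over the whole square of pairs.
collision-count : ∀ n s ji → 2 ^ s * length (filter (λ π → collision? n s π ji) (S n)) ≤ card n
collision-count n s ji@(j , i) = case (j <? i) ×-dec (i + s * 2 ≤? n) of λ where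
  (no  ¬jin)       → ≤-trans (≤-reflexive (trans
    (cong (λ xs → 2 ^ s * length xs)
      (filter-none (λ π → collision? n s π ji) {xs = S n} (All.tabulate λ _ (j<i , i≤ , _) → ¬jin (j<i , i≤))))
    (*-zeroʳ (2 ^ s)))) z≤n
  (yes (j<i , i≤)) → ≤-trans
    (*-monoʳ-≤ (2 ^ s) (length-⊆ (Unique.filter⁺ (λ π → collision? n s π ji) (S-unique n)) λ π∈ →
      let π∈S , _ , _ , c = ∈-filter⁻ (λ π → collision? n s π ji) {xs = S n} π∈
      in ∈-filter⁺ (collide? s j i) π∈S c))
    (collide-count s j<i i≤)

-- Exchange of summation: the related pairs are counted by their second component instead of their
-- first. The induction removes one `y` at a time by `split`.
sum-length-filter : ∀ {A B : Set} {R : A → B → Set} (R? : ∀ x y → Dec (R x y)) K C xs ys →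
  (∀ y → K * length (filter (λ x → R? x y) xs) ≤ C) →
  K * sum (map (λ x → length (filter (R? x) ys)) xs) ≤ length ys * C
sum-length-filter R? K C xs [] h = ≤-reflexive (trans (cong (K *_) (zeros xs)) (*-zeroʳ K))
  where
  zeros : ∀ xs → sum (map (λ x → 0) xs) ≡ 0
  zeros []       = refl
  zeros (x ∷ xs) = zeros xs
sum-length-filter R? K C xs (y ∷ ys) h = begin
  K * sum (map (λ x → length (filter (R? x) (y ∷ ys))) xs)
    ≡⟨ cong (K *_) (split xs) ⟩
  K * (length (filter (λ x → R? x y) xs) + sum (map (λ x → length (filter (R? x) ys)) xs))
    ≡⟨ *-distribˡ-+ K (length (filter (λ x → R? x y) xs)) _ ⟩
  K * length (filter (λ x → R? x y) xs) + K * sum (map (λ x → length (filter (R? x) ys)) xs)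
    ≤⟨ +-mono-≤ (h y) (sum-length-filter R? K C xs ys h) ⟩
  C + length ys * C ∎
  where
  open ≤-Reasoning
  swap-+ : ∀ a b c → a + (b + c) ≡ b + (a + c)
  swap-+ = solve-∀
  split : ∀ xs → sum (map (λ x → length (filter (R? x) (y ∷ ys))) xs) ≡
    length (filter (λ x → R? x y) xs) + sum (map (λ x → length (filter (R? x) ys)) xs)
  split []       = refl
  split (x ∷ xs) with does (R? x y)
  ... | true  = cong suc (trans (cong (length (filter (R? x) ys) +_) (split xs))
                  (swap-+ (length (filter (R? x) ys)) (length (filter (λ x → R? x y) xs)) _))
  ... | false = trans (cong (length (filter (R? x) ys) +_) (split xs))
                  (swap-+ (length (filter (R? x) ys)) (length (filter (λ x → R? x y) xs)) _)

length-cartesianProduct : ∀ {A B : Set} (xs : List A) (ys : List B) →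
  length (cartesianProduct xs ys) ≡ length xs * length ys
length-cartesianProduct []       ys = refl
length-cartesianProduct (x ∷ xs) ys =
  trans (length-++ (map (x ,_) ys)) (cong₂ _+_ (length-map (x ,_) ys) (length-cartesianProduct xs ys))

length-pairs : ∀ n → length (pairs n) ≡ n * n
length-pairs n = trans (length-cartesianProduct (upTo n) (upTo n)) (cong₂ _*_ (length-upTo n) (length-upTo n))

sum-collisions : ∀ n s → 2 ^ s * sum (map (collisions n s) (S n)) ≤ n * n * card n
sum-collisions n s = subst (λ l → 2 ^ s * sum (map (collisions n s) (S n)) ≤ l * card n) (length-pairs n)
  (sum-length-filter (collision? n s) (2 ^ s) (card n) (S n) (pairs n) (collision-count n s))

-- There are `n ∸ k` windows of length `suc k`. Applying `distinct-values` to their standardizations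
-- turns distinct values into patterns and coincidences into collisions.
patterns-≥ : ∀ {n π} s k → Perm n π → s * 2 ≤ suc k → suc k ≤ n →
  n ≤ length (patterns π (suc k)) + collisions n s π + k
patterns-≥ {n} {π} s k (perm refl _ u) s≤k k<n
  with xs , ps , uxs , xs-val , ups , ps-coll , w≤ ←
    distinct-values (≡-dec _≟_) (std ∘ window (suc k) π) (n ∸ k) = begin
  n                                                            ≡⟨ m∸n+n≡m (<⇒≤ k<n) ⟨
  n ∸ k + k                                                    ≤⟨ +-monoˡ-≤ k (≤-trans w≤ (+-mono-≤ xs≤ ps≤)) ⟩
  length (patterns π (suc k)) + collisions n s π + k           ∎
  where
  open ≤-Reasoning
  fits : ∀ {i} → i < n ∸ k → i + suc k ≤ n
  fits {i} i< = subst (_≤ n) (sym (+-suc i k)) (m≤o∸n⇒m+n≤o (suc i) (<⇒≤ k<n) i<)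
  xs≤ : length xs ≤ length (patterns π (suc k))
  xs≤ = length-⊆ uxs λ x∈ → case xs-val x∈ of λ where
    (i , i< , refl) → std-window-∈ u (fits i<)
  ps≤ : length ps ≤ collisions n s π
  ps≤ = length-⊆ ups λ p∈ →
    let j<i , i< , eq = ps-coll p∈
        i<n = <-≤-trans i< (m∸n≤m n k)
        j+k≤ = ≤-trans (+-monoˡ-≤ (suc k) (<⇒≤ j<i)) (fits i<)
    in ∈-filter⁺ (collision? n s π)
         (∈-cartesianProduct⁺ (∈-upTo⁺ (<-trans j<i i<n)) (∈-upTo⁺ i<n))
         (j<i , ≤-trans (+-monoʳ-≤ _ s≤k) (fits i<) , std-window-collide s u s≤k j+k≤ (fits i<) eq)

-- Summation over the pattern lengths

sum-upTo-suc : ∀ (f : ℕ → ℕ) N → sum (map f (upTo (suc N))) ≡ sum (map f (upTo N)) + f N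
sum-upTo-suc f N = begin
  sum (map f (upTo (suc N)))               ≡⟨ cong (sum ∘ map f) (upTo-∷ʳ N) ⟨
  sum (map f (upTo N ++ [ N ]))            ≡⟨ cong sum (map-++ f (upTo N) [ N ]) ⟩
  sum (map f (upTo N) ++ [ f N ])          ≡⟨ sum-++ (map f (upTo N)) [ f N ] ⟩
  sum (map f (upTo N)) + (f N + 0)         ≡⟨ cong (sum (map f (upTo N)) +_) (+-identityʳ (f N)) ⟩
  sum (map f (upTo N)) + f N               ∎
  where open ≡-Reasoning

-- Twice the sum of all `k` below `N` is N² - N; the negative terms are moved across to avoid
-- truncated subtraction.
sum-upTo-≤ : ∀ {n} (f : ℕ → ℕ) N → (∀ k → k < N → f k + k ≤ n) →
  2 * sum (map f (upTo N)) + N * N ≤ 2 * (N * n) + N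
sum-upTo-≤ f zero    h = z≤n
sum-upTo-≤ {n} f (suc N) h rewrite sum-upTo-suc f N = subst₂ _≤_
  (lhs (sum (map f (upTo N))) (f N) N) (rhs N n)
  -- The added one completes N² + 2N to (N + 1)² on the left and `N` to `suc N` on the right.
  (s≤s (+-mono-≤ (sum-upTo-≤ f N (λ k k<N → h k (m<n⇒m<1+n k<N))) (*-monoʳ-≤ 2 (h N (n<1+n N)))))
  where
  lhs : ∀ s x N → suc (2 * s + N * N + 2 * (x + N)) ≡ 2 * (s + x) + suc N * suc N
  lhs = solve-∀
  rhs : ∀ N n → suc (2 * (N * n) + N + 2 * n) ≡ 2 * (suc N * n) + suc N
  rhs = solve-∀

-- Lengths below the threshold `t` have no lower bound and forfeit at most `n` each, whence the term
-- `2 * (t * n)`.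
sum-upTo-≥ : ∀ {n t C} (f : ℕ → ℕ) N → (∀ k → k < N → t ≤ suc k → n ≤ f k + C + k) →
  2 * (N * n) ≤ 2 * sum (map f (upTo N)) + 2 * (N * C) + N * N + 2 * (t * n)
sum-upTo-≥ f zero    h = z≤n
sum-upTo-≥ {n} {t} {C} f (suc N) h with t ≤? suc N
-- All lengths so far are below the threshold, so the last summand absorbs the whole left side.
... | no  t≰ = ≤-trans (*-monoʳ-≤ 2 (*-monoˡ-≤ n (<⇒≤ (≰⇒> t≰))))
    (m≤n+m (2 * (t * n)) (2 * sum (map f (upTo (suc N))) + 2 * (suc N * C) + suc N * suc N))
... | yes t≤ rewrite sum-upTo-suc f N = subst₂ _≤_
  (lhs N n) (rhs (sum (map f (upTo N))) (f N) N C (t * n))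
  (m≤n⇒m≤1+n (+-mono-≤ (sum-upTo-≥ f N (λ k k<N → h k (m<n⇒m<1+n k<N)))
                       (*-monoʳ-≤ 2 (h N (n<1+n N) t≤))))
  where
  lhs : ∀ N n → 2 * (N * n) + 2 * n ≡ 2 * (suc N * n)
  lhs = solve-∀
  rhs : ∀ s x N C a → suc (2 * s + 2 * (N * C) + N * N + 2 * a + 2 * (x + C + N)) ≡
    2 * (s + x) + 2 * (suc N * C) + suc N * suc N + 2 * a
  rhs = solve-∀

-- Bounds on `φ`, its total and its maximum

φ-≤ : ∀ π → let n = length π in 2 * φ π ≤ n * n + n
φ-≤ π = +-cancelʳ-≤ (n * n) (2 * φ π) (n * n + n) (≤-trans
  (sum-upTo-≤ (length ∘ patterns π ∘ suc) n bound) (≤-reflexive (ring n)))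
  where
  n = length π
  bound : ∀ k → k < n → length (patterns π (suc k)) + k ≤ n
  bound k k<n = begin
    length (patterns π (suc k)) + k   ≤⟨ +-monoˡ-≤ k (patterns-≤ π (suc k)) ⟩
    suc (n ∸ suc k) + k               ≡⟨ +-suc (n ∸ suc k) k ⟨
    n ∸ suc k + suc k                 ≡⟨ m∸n+n≡m k<n ⟩
    n                                 ∎
    where open ≤-Reasoning
  ring : ∀ n → 2 * (n * n) + n ≡ n * n + n + n * n
  ring = solve-∀

-- `sum-upTo-≥` over all `n` lengths with threshold `s * 2`; the lengths themselves use up half of
-- 2n².
φ-≥ : ∀ {n π} s → Perm n π → n * n ≤ 2 * φ π + 2 * n * collisions n s π + 2 * (s * 2 * n)
φ-≥ {n} {π} s p@(perm refl _ _) = +-cancelʳ-≤ (n * n) (n * n) _ (subst₂ _≤_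
  (lhs n) (rhs (φ π) n (collisions n s π) (s * 2 * n))
  (sum-upTo-≥ (length ∘ patterns π ∘ suc) n (λ k k<n s≤k → patterns-≥ s k p s≤k k<n)))
  where
  lhs : ∀ n → 2 * (n * n) ≡ n * n + n * n
  lhs = solve-∀
  rhs : ∀ x n c a → 2 * x + 2 * (n * c) + n * n + 2 * a ≡ 2 * x + 2 * n * c + 2 * a + n * n
  rhs = solve-∀

sum-≥ : ∀ {A : Set} (f g : A → ℕ) {a} b {d} xs → (∀ {x} → x ∈ xs → a ≤ 2 * f x + b * g x + d) →
  length xs * a ≤ 2 * sum (map f xs) + b * sum (map g xs) + length xs * d
sum-≥ f g b []       h = z≤n
sum-≥ f g b {d} (x ∷ xs) h = ≤-trans (+-mono-≤ (h (here refl)) (sum-≥ f g b xs (h ∘ there)))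
  (≤-reflexive (ring (f x) (g x) (sum (map f xs)) (sum (map g xs)) b d (length xs * d)))
  where
  ring : ∀ x y s r b d l → 2 * x + b * y + d + (2 * s + b * r + l) ≡ 2 * (x + s) + b * (y + r) + (d + l)
  ring = solve-∀

sumφ-≥ : ∀ n s →
  card n * (n * n) ≤ 2 * sumφ n + 2 * n * sum (map (collisions n s) (S n)) + card n * (2 * (s * 2 * n))
sumφ-≥ n s = sum-≥ φ (collisions n s) (2 * n) (S n) (λ π∈ → φ-≥ s (∈-S⁻ π∈))

sum≤length*max : ∀ xs → sum xs ≤ length xs * foldr _⊔_ 0 xs
sum≤length*max []       = z≤n
sum≤length*max (x ∷ xs) = +-mono-≤ (m≤m⊔n x _)
  (≤-trans (sum≤length*max xs) (*-monoʳ-≤ (length xs) (m≤n⊔m x _)))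

sumφ≤card*maxφ : ∀ n → sumφ n ≤ card n * maxφ n
sumφ≤card*maxφ n = subst (λ l → sumφ n ≤ l * maxφ n) (length-map φ (S n)) (sum≤length*max (map φ (S n)))

maxφ-≤ : ∀ n → 2 * maxφ n ≤ n * n + n
maxφ-≤ n = go (S n) (λ {π} π∈ → subst (λ l → 2 * φ π ≤ l * l + l) (length≡ (∈-S⁻ {n} π∈)) (φ-≤ π))
  where
  go : ∀ πs → (∀ {π} → π ∈ πs → 2 * φ π ≤ n * n + n) → 2 * foldr _⊔_ 0 (map φ πs) ≤ n * n + n
  go []       h = z≤n
  go (π ∷ πs) h = ≤-trans (≤-reflexive (*-distribˡ-⊔ 2 (φ π) _)) (⊔-lub (h (here refl)) (go πs (h ∘ there)))

-- Asymptotics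

*-∣-∣-≤ : ∀ k {a b q} → k * a ≤ k * b + q → k * b ≤ k * a + q → k * ∣ a - b ∣ ≤ q
*-∣-∣-≤ k {a} {b} {q} a≤ b≤ rewrite *-distribˡ-∣-∣ k a b with ∣m-n∣≡[m∸n]∨[n∸m] (k * a) (k * b)
... | inj₁ eq = ≤-trans (≤-reflexive eq) (m≤n+o⇒m∸n≤o (k * a) (k * b) a≤)
... | inj₂ eq = ≤-trans (≤-reflexive eq) (m≤n+o⇒m∸n≤o (k * b) (k * a) b≤)

-- The limit as integer arithmetic: `E / c` is the expectation, `M` the maximum, `V` the total
-- number of collisions, `t` the length threshold and `1 / J` the tolerance.
module Estimates
  (J c n E M V t : ℕ)
  (E≤cM : E ≤ c * M)
  (2M≤ : 2 * M ≤ n * n + n)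
  (2E≥ : c * (n * n) ≤ 2 * E + 2 * n * V + c * (2 * (t * n)))
  (V≤ : 8 * suc J * n * V ≤ n * n * c)
  (t≤ : 8 * suc J * t ≤ n)
  (J≤ : 2 * J ≤ n)
  where
  open ≤-Reasoning

  Q err : ℕ
  Q = c * (n * n)
  err = 2 * n * V + c * (2 * (t * n))

  Q≤ : Q ≤ 2 * E + err
  Q≤ = ≤-trans 2E≥ (≤-reflexive (+-assoc (2 * E) _ _))

  2cM≤ : 2 * (c * M) ≤ Q + c * n
  2cM≤ = begin
    2 * (c * M)        ≡⟨ ring c M ⟩
    c * (2 * M)        ≤⟨ *-monoʳ-≤ c 2M≤ ⟩
    c * (n * n + n)    ≡⟨ *-distribˡ-+ c (n * n) n ⟩
    Q + c * n          ∎
    where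
    ring : ∀ c M → 2 * (c * M) ≡ c * (2 * M)
    ring = solve-∀

  -- After multiplication by `suc J`, each of the two parts of `err` is at most a quarter of `Q`;
  -- this is the origin of the constant 8 in `V≤` and `t≤`.
  err≤ : 2 * (suc J * err) ≤ Q
  err≤ = *-cancelˡ-≤ 2 (begin
    2 * (2 * (suc J * err))                            ≡⟨ lhs (suc J) n V c t ⟩
    8 * suc J * n * V + 8 * suc J * t * (n * c)        ≤⟨ +-mono-≤ V≤ (*-monoˡ-≤ (n * c) t≤) ⟩
    n * n * c + n * (n * c)                            ≡⟨ rhs n c ⟩
    2 * Q                                              ∎)
    where
    lhs : ∀ K n V c t → 2 * (2 * (K * (2 * n * V + c * (2 * (t * n))))) ≡ 8 * K * n * V + 8 * K * t * (n * c)
    lhs = solve-∀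
    rhs : ∀ n c → n * n * c + n * (n * c) ≡ 2 * (c * (n * n))
    rhs = solve-∀

  Jcn≤ : 2 * (J * (c * n)) ≤ Q
  Jcn≤ = begin
    2 * (J * (c * n))    ≡⟨ lhs J c n ⟩
    2 * J * (c * n)      ≤⟨ *-monoˡ-≤ (c * n) J≤ ⟩
    n * (c * n)          ≡⟨ rhs n c ⟩
    Q                    ∎
    where
    lhs : ∀ J c n → 2 * (J * (c * n)) ≡ 2 * J * (c * n)
    lhs = solve-∀
    rhs : ∀ n c → n * (c * n) ≡ c * (n * n)
    rhs = solve-∀

  -- Of the `suc J` copies of `err` bounded by `err≤`, one pays for the loss in `Q≤` and `J` remain.
  errors≤2E : J * err + J * (c * n) ≤ 2 * E
  errors≤2E = +-cancelˡ-≤ err _ _ (begin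
    err + (J * err + J * (c * n))     ≡⟨ +-assoc err _ _ ⟨
    suc J * err + J * (c * n)         ≤⟨ *-cancelˡ-≤ 2 doubled ⟩
    Q                                 ≤⟨ Q≤ ⟩
    2 * E + err                       ≡⟨ +-comm (2 * E) err ⟩
    err + 2 * E                       ∎)
    where
    doubled : 2 * (suc J * err + J * (c * n)) ≤ 2 * Q
    doubled = begin
      2 * (suc J * err + J * (c * n))            ≡⟨ *-distribˡ-+ 2 (suc J * err) _ ⟩
      2 * (suc J * err) + 2 * (J * (c * n))      ≤⟨ +-mono-≤ err≤ Jcn≤ ⟩
      Q + Q                                      ≡⟨ cong (Q +_) (+-identityʳ Q) ⟨
      2 * Q                                      ∎

  -- One direction is `E≤cM`. The other compares `c * M` with `E` through `Q`, and `errors≤2E`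
  -- absorbs both errors.
  E≈cM : J * ∣ E - c * M ∣ ≤ c * M
  E≈cM = *-∣-∣-≤ J (m≤n⇒m≤n+o (c * M) (*-monoʳ-≤ J E≤cM)) (*-cancelˡ-≤ 2 (begin
    2 * (J * (c * M))                             ≡⟨ swap-* J (c * M) ⟩
    J * (2 * (c * M))                             ≤⟨ *-monoʳ-≤ J 2cM≤ ⟩
    J * (Q + c * n)                               ≤⟨ *-monoʳ-≤ J (+-monoˡ-≤ (c * n) Q≤) ⟩
    J * (2 * E + err + c * n)                     ≡⟨ expand J E err (c * n) ⟩
    2 * (J * E) + (J * err + J * (c * n))         ≤⟨ +-monoʳ-≤ (2 * (J * E)) (≤-trans errors≤2E (*-monoʳ-≤ 2 E≤cM)) ⟩
    2 * (J * E) + 2 * (c * M)                     ≡⟨ *-distribˡ-+ 2 (J * E) (c * M) ⟨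
    2 * (J * E + c * M)                           ∎))
    where
    swap-* : ∀ J x → 2 * (J * x) ≡ J * (2 * x)
    swap-* = solve-∀
    expand : ∀ J E e x → J * (2 * E + e + x) ≡ 2 * (J * E) + (J * e + J * x)
    expand = solve-∀

  2E≈Q : J * ∣ 2 * E - Q ∣ ≤ Q
  2E≈Q = *-∣-∣-≤ J
    (begin
      J * (2 * E)              ≤⟨ *-monoʳ-≤ J (≤-trans (*-monoʳ-≤ 2 E≤cM) 2cM≤) ⟩
      J * (Q + c * n)          ≡⟨ *-distribˡ-+ J Q (c * n) ⟩
      J * Q + J * (c * n)      ≤⟨ +-monoʳ-≤ (J * Q) (≤-trans (m≤n*m _ 2) Jcn≤) ⟩
      J * Q + Q                ∎)
    (begin
      J * Q                        ≤⟨ *-monoʳ-≤ J Q≤ ⟩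
      J * (2 * E + err)            ≡⟨ *-distribˡ-+ J (2 * E) err ⟩
      J * (2 * E) + J * err        ≤⟨ +-monoʳ-≤ (J * (2 * E)) (≤-trans (*-monoˡ-≤ err (n≤1+n J)) (≤-trans (m≤n*m _ 2) err≤)) ⟩
      J * (2 * E) + Q              ∎)

-- With s ≈ n / 16 K, windows of length 2 s are short compared with n, while 2 ^ s
-- exceeds 8 K n; taking s even gives 2 ^ s ≥ (s / 2 + 1)².
window-size : ∀ K .{{_ : NonZero K}} n → let B = 32 * K in B * B * B ≤ n →
  ∃ λ s → 8 * K * (s * 2) ≤ n × 8 * K * n ≤ 2 ^ s
window-size K@(suc _) n B³≤n = u + u , short , large
  where
  open ≤-Reasoning
  -- With `s` equal to `u + u`, the threshold `s * 2` is `4 * u`, and 8 · 4 = 32.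
  B = 32 * K
  u = n / B

  short : 8 * K * ((u + u) * 2) ≤ n
  short = ≤-trans (≤-reflexive (ring K u)) (m/n*n≤m n B)
    where
    ring : ∀ K u → 8 * K * ((u + u) * 2) ≡ u * (32 * K)
    ring = solve-∀

  n≤ : n ≤ B * suc u
  n≤ = begin
    n                    ≡⟨ m≡m%n+[m/n]*n n B ⟩
    n % B + u * B        ≤⟨ +-monoˡ-≤ (u * B) (<⇒≤ (m%n<n n B)) ⟩
    B + u * B            ≡⟨ *-comm (suc u) B ⟩
    B * suc u            ∎

  -- The cubic lower bound on `n` serves this: one factor `suc u` in `large` absorbs the constant
  -- `B * B`.
  B²≤u : B * B ≤ u
  B²≤u = ≤-trans (≤-reflexive (sym (m*n/n≡m (B * B) B))) (/-monoˡ-≤ B B³≤n)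

  large : 8 * K * n ≤ 2 ^ (u + u)
  large = begin
    8 * K * n              ≤⟨ *-mono-≤ (*-monoˡ-≤ K (m≤m+n 8 24)) n≤ ⟩
    B * (B * suc u)        ≡⟨ *-assoc B B (suc u) ⟨
    B * B * suc u          ≤⟨ *-mono-≤ (≤-trans B²≤u (n≤1+n u)) ≤-refl ⟩
    suc u * suc u          ≤⟨ *-mono-≤ (n<2^n u) (n<2^n u) ⟩
    2 ^ u * 2 ^ u          ≡⟨ ^-distribˡ-+-* 2 u u ⟨
    2 ^ (u + u)            ∎
    where
    n<2^n : ∀ n → n < 2 ^ n
    n<2^n zero    = s≤s z≤n
    n<2^n (suc n) = ≤-trans (+-mono-≤ (m^n>0 2 n) (n<2^n n)) (≤-reflexive (cong (2 ^ n +_) (sym (+-identityʳ (2 ^ n)))))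

-- Convergence with denominators cleared: each quotient is within 1/(j + 1) of 1 from some `N` on,
-- and `sumφ n` is `card n` times the expectation.
mainTheorem1 : (j : ℕ) → Σ ℕ (λ N → (n : ℕ) → N ≤ n →
    (suc j * ∣ sumφ n - card n * maxφ n ∣ ≤ card n * maxφ n)
    × (suc j * ∣ 2 * sumφ n - card n * n ^ 2 ∣ ≤ card n * n ^ 2))
mainTheorem1 j = B * B * B , λ n N≤n →
  let s , short , large = window-size K n N≤n
      V = sum (map (collisions n s) (S n))
      open Estimates (suc j) (card n) n (sumφ n) (maxφ n) V (s * 2)
        (sumφ≤card*maxφ n) (maxφ-≤ n) (sumφ-≥ n s)
        -- The power `2 ^ s` links the two bounds: `8 * K * n * V ≤ 2 ^ s * V ≤ n * n * card n`.
        (≤-trans (*-monoˡ-≤ V large) (sum-collisions n s)) short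
        (≤-trans J≤B³ N≤n)
  in E≈cM , subst (λ m → suc j * ∣ 2 * sumφ n - card n * m ∣ ≤ card n * m)
              (sym (cong (n *_) (*-identityʳ n))) 2E≈Q
  where
  -- `Estimates` is applied with `J` equal to `suc j`, and its hypotheses involve `suc J`.
  K = suc (suc j)
  B = 32 * K
  J≤B³ : 2 * suc j ≤ B * B * B
  J≤B³ = ≤-trans (*-mono-≤ (m≤m+n 2 30) (n≤1+n (suc j))) (m≤n*m B (B * B))
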